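{- Let $\Gamma$ be a graph and let $G \leq \mathrm{Aut}(\Gamma)$ be such that the quotient graph $\Gamma/G$ is connected. Then there exist functions $\zeta \colon D(\Gamma/G) \to G$ and $\omega \colon V(\Gamma/G) \cup D(\Gamma/G) \to S(G)$ such that $(\Gamma/G,G,\omega,\zeta)$ is a generalised voltage graph and $\Gamma$ is isomorphic to the associated generalised cover $\mathrm{GenCov}(\Gamma/G,G,\omega,\zeta)$.
   Context: Graphs. A graph is a quadruple $(V,D,\mathrm{beg},\mathrm{inv})$ where $V$ is a non-empty set of vertices, $D$ is a set of darts (disjoint from $V$), $\mathrm{beg}\colon D\to V$, and $\mathrm{inv}\colon D\to D$ satisfies $\mathrm{inv}\,\mathrm{inv}\,x=x$ for all $x\in D$. For $\Gamma=(V,D,\mathrm{beg},\mathrm{inv})$ write $V(\Gamma)=V$, $D(\Gamma)=D$, $\mathrm{beg}_\Gamma=\mathrm{beg}$, $\mathrm{inv}_\Gamma=\mathrm{inv}$; also $x^{ -1}:=\mathrm{inv}\,x$ and $\mathrm{end}\,x:=\mathrm{beg}\,x^{ -1}$ for a dart $x$. A walk is a sequence of darts $(x_1,\dots,x_n)$ with $\mathrm{end}\,x_i=\mathrm{beg}\,x_{i+1}$; a walk of length $0$ is regarded as a walk from any vertex $v$ to itself. A graph is connected if for any two vertices $u,v$ there is a walk from $u$ to $v$. A morphism $\Gamma\to\Delta$ is a function $V(\Gamma)\cup D(\Gamma)\to V(\Delta)\cup D(\Delta)$ mapping vertices to vertices and darts to darts and commuting with $\mathrm{beg}$ and $\mathrm{inv}$;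 an isomorphism is a bijective morphism; an automorphism is an isomorphism of a graph onto itself. $\mathrm{Aut}(\Gamma)$ acts on the right (image of $x$ under $g$ is $x^g$, and $x^{gh}=(x^g)^h$). Quotients. For $G\le \mathrm{Aut}(\Gamma)$, $x^G$ denotes the $G$-orbit of $x$, and $\Gamma/G$ is the graph whose vertices and darts are the $G$-orbits on $V(\Gamma)$ and on $D(\Gamma)$, with $\mathrm{beg}(x^G)=(\mathrm{beg}\,x)^G$ and $\mathrm{inv}(x^G)=(\mathrm{inv}\,x)^G$. Generalised voltage graphs. For a group $G$, $S(G)$ is the set of all subgroups of $G$, and $g^h:=h^{ -1}gh$, $H^h:=h^{ -1}Hh$. A generalised voltage graph is a quadruple $(\Delta,G,\omega,\zeta)$ where $\Delta$ is a connected graph, $G$ is a group, and $\omega\colon V(\Delta)\cup D(\Delta)\to S(G)$ and $\zeta\colon D(\Delta)\to G$ satisfy, for all $x\in D(\Delta)$: $\omega(x)\le\omega(\mathrm{beg}_\Delta x)$; $\omega(x)=\omega(x^{ -1})^{\zeta(x)}$; and $\zeta(x^{ -1})\zeta(x)\in\omega(x)$. Generalised cover. $\mathrm{GenCov}(\Delta,G,\omega,\zeta)$ is the graph $\Theta$ with $V(\Theta)=\{(v,\omega(v)g): v\in V(\Delta), g\in G\}$, $D(\Theta)=\{(x,\omega(x)g): x\in D(\Delta), g\in G\}$, $\mathrm{beg}_\Theta(x,\omega(x)g)=(\mathrm{beg}_\Delta x,\omega(\mathrm{beg}_\Delta x)g)$ and $\mathrm{inv}_\Theta(x,\omega(x)g)=(x^{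 -1},\omega(x^{ -1})\zeta(x)g)$ (here $\omega(x)g$ are right cosets). -}

module Defs where

open import Level using (Level; suc)
open import Algebra.Bundles using (Group)
import Algebra.Properties.Group as GroupProperties
open import Data.Product using (Σ-syntax; ∃-syntax; _×_; _,_; proj₁; proj₂)
open import Data.Sum using (inj₁; inj₂)
open import Data.Sum.Relation.Binary.Pointwise using (_⊎ₛ_; inj₁; inj₂)
open import Function.Bundles using (Func; _⟨$⟩_)
open import Function.Definitions using (Bijective)
import Function.Construct.Composition as Compose
import Function.Construct.Identity as Identity
open import Relation.Binary.Bundles using (Setoid)
open import Relation.Binary.Core using (REL)
open import Relation.Binary.Definitions using (_Respectsˡ_; _Respectsʳ_)
open import Relation.Unary using (Pred; _∈_; _⊆_; _≐_)
open import Relation.Unary.Properties using (≐-refl; ≐-sym; ≐-trans)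
import Relation.Binary.Reasoning.Setoid as SetoidReasoning

-- Zermelo's axiom of choice for sets with an equality.  By Diaconescu's
-- argument it entails excluded middle, so it provides the full classical
-- background.  The relation must respect both equalities: otherwise it is not
-- a relation between the sets represented by A and B, and choice would be
-- inconsistent.
AxiomOfChoice : (ℓ : Level) → Set (suc ℓ)
AxiomOfChoice ℓ =
  (A B : Setoid ℓ ℓ) (R : REL (Setoid.Carrier A) (Setoid.Carrier B) ℓ) →
  R Respectsˡ Setoid._≈_ A → R Respectsʳ Setoid._≈_ B →
  (∀ a → ∃[ b ] R a b) →
  Σ[ f ∈ Func A B ] (∀ a → R a (f ⟨$⟩ a))

------------------------------------------------------------------------
-- Subgroups and cosets

module _ {ℓ : Level} (G : Group ℓ ℓ) where
  open Group G

  record Subgroup : Set (suc ℓ) where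
    field
      member    : Pred Carrier ℓ
      resp-≈    : ∀ {g h} → g ≈ h → g ∈ member → h ∈ member
      ε-closed  : ε ∈ member
      ∙-closed  : ∀ {g h} → g ∈ member → h ∈ member → g ∙ h ∈ member
      ⁻¹-closed : ∀ {g} → g ∈ member → g ⁻¹ ∈ member

  open Subgroup

  subgroups : Setoid (suc ℓ) ℓ
  subgroups = record
    { Carrier       = Subgroup
    ; _≈_           = λ H K → member H ≐ member K
    ; isEquivalence = record { refl = ≐-refl ; sym = ≐-sym ; trans = ≐-trans }
    }

  subgroupGroup : Subgroup → Group ℓ ℓ
  subgroupGroup H = record
    { Carrier = Σ[ g ∈ Carrier ] g ∈ member H
    ; _≈_     = λ g h → proj₁ g ≈ proj₁ h
    ; _∙_     = λ (g , g∈H) (h , h∈H) → g ∙ h , ∙-closed H g∈H h∈H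
    ; ε       = ε , ε-closed H
    ; _⁻¹     = λ (g , g∈H) → g ⁻¹ , ⁻¹-closed H g∈H
    ; isGroup = record
      { isMonoid = record
        { isSemigroup = record
          { isMagma = record
            { isEquivalence = record { refl = refl ; sym = sym ; trans = trans }
            ; ∙-cong        = ∙-cong
            }
          ; assoc = λ g h k → assoc (proj₁ g) (proj₁ h) (proj₁ k)
          }
        ; identity = (λ g → identityˡ (proj₁ g)) , (λ g → identityʳ (proj₁ g))
        }
      ; inverse = (λ g → inverseˡ (proj₁ g)) , (λ g → inverseʳ (proj₁ g))
      ; ⁻¹-cong = ⁻¹-cong
      }
    }

  -- H^h = h⁻¹Hh
  conjugate : Subgroup → Carrier → Pred Carrier ℓ
  conjugate H h k = ∃[ a ] a ∈ member H × k ≈ h ⁻¹ ∙ a ∙ h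

  -- Hg
  rightCoset : Subgroup → Carrier → Pred Carrier ℓ
  rightCoset H g k = ∃[ a ] a ∈ member H × k ≈ a ∙ g

  rightCoset-⊆ : ∀ H K {g h a} → member H ⊆ member K →
                 a ∈ member K → g ≈ a ∙ h → rightCoset H g ⊆ rightCoset K h
  rightCoset-⊆ H K H⊆K a∈K g≈ah (b , b∈H , k≈bg) =
    _ , ∙-closed K (H⊆K b∈H) a∈K
      , trans k≈bg (trans (∙-congˡ g≈ah) (sym (assoc _ _ _)))

  rightCoset-≐ : ∀ H K {g h a} → member H ≐ member K →
                 a ∈ member K → g ≈ a ∙ h → rightCoset H g ≐ rightCoset K h
  rightCoset-≐ H K {g} {h} {a} (H⊆K , K⊆H) a∈K g≈ah =
    rightCoset-⊆ H K H⊆K a∈K g≈ah ,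
    rightCoset-⊆ K H K⊆H (K⊆H (⁻¹-closed K a∈K))
      (sym (trans (∙-congˡ g≈ah) (\\-leftDividesʳ a h)))
    where open GroupProperties G

  rightCoset-self : ∀ H g → g ∈ rightCoset H g
  rightCoset-self H g = ε , ε-closed H , sym (identityˡ g)

------------------------------------------------------------------------
-- Graphs

record Graph (ℓ : Level) : Set (suc ℓ) where
  field
    V D            : Setoid ℓ ℓ
    beg            : Func D V
    inv            : Func D D
    inv-involutive : ∀ x → Setoid._≈_ D (inv ⟨$⟩ (inv ⟨$⟩ x)) x
    nonEmpty       : Setoid.Carrier V

  module V = Setoid V
  module D = Setoid D

  end : Func D V
  end = Compose.function inv beg

  V∪D : Setoid ℓ ℓ
  V∪D = V ⊎ₛ D

module _ {ℓ : Level} (Γ : Graph ℓ) where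
  open Graph Γ

  data Walk : V.Carrier → V.Carrier → Set ℓ where
    empty : ∀ {u v} → u V.≈ v → Walk u v
    step  : ∀ {u v} (x : D.Carrier) → u V.≈ (beg ⟨$⟩ x) → Walk (end ⟨$⟩ x) v → Walk u v

  Connected : Set ℓ
  Connected = ∀ u v → Walk u v

-- A map V ∪ D → V ∪ D taking vertices to vertices and darts to darts is given
-- by its two restrictions, and it is bijective iff both of them are.
record Morphism {ℓ : Level} (Γ Δ : Graph ℓ) : Set ℓ where
  private
    module Γ = Graph Γ
    module Δ = Graph Δ
  field
    onV     : Func Γ.V Δ.V
    onD     : Func Γ.D Δ.D
    beg-hom : ∀ x → (Δ.beg ⟨$⟩ (onD ⟨$⟩ x)) Δ.V.≈ (onV ⟨$⟩ (Γ.beg ⟨$⟩ x))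
    inv-hom : ∀ x → (Δ.inv ⟨$⟩ (onD ⟨$⟩ x)) Δ.D.≈ (onD ⟨$⟩ (Γ.inv ⟨$⟩ x))

record Isomorphism {ℓ : Level} (Γ Δ : Graph ℓ) : Set ℓ where
  private
    module Γ = Graph Γ
    module Δ = Graph Δ
  field
    morphism : Morphism Γ Δ
  open Morphism morphism public
  field
    bijectiveV : Bijective Γ.V._≈_ Δ.V._≈_ (onV ⟨$⟩_)
    bijectiveD : Bijective Γ.D._≈_ Δ.D._≈_ (onD ⟨$⟩_)

------------------------------------------------------------------------
-- The automorphism group

module _ {ℓ : Level} {S T : Setoid ℓ ℓ} (f : Func S T)
         (bij : Bijective (Setoid._≈_ S) (Setoid._≈_ T) (f ⟨$⟩_)) where
  private
    module S = Setoid S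
    module T = Setoid T
    f⁻¹ : T.Carrier → S.Carrier
    f⁻¹ y = proj₁ (proj₂ bij y)

  to∘from : ∀ y → (f ⟨$⟩ f⁻¹ y) T.≈ y
  to∘from y = proj₂ (proj₂ bij y) S.refl

  from∘to : ∀ x → f⁻¹ (f ⟨$⟩ x) S.≈ x
  from∘to x = proj₁ bij (to∘from (f ⟨$⟩ x))

  inverseFunc : Func T S
  inverseFunc = record
    { to   = f⁻¹
    ; cong = λ {x} {y} x≈y →
        proj₁ bij (T.trans (to∘from x) (T.trans x≈y (T.sym (to∘from y))))
    }

  inverseFunc-bijective : Bijective T._≈_ S._≈_ (inverseFunc ⟨$⟩_)
  inverseFunc-bijective =
    (λ {x} {y} p → T.trans (T.sym (to∘from x)) (T.trans (Func.cong f p) (to∘from y))) ,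
    (λ x → f ⟨$⟩ x , λ p → S.trans (Func.cong inverseFunc p) (from∘to x))

module _ {ℓ : Level} {Γ Δ : Graph ℓ} where
  private
    module Γ = Graph Γ
    module Δ = Graph Δ

  isoInverse : Isomorphism Γ Δ → Isomorphism Δ Γ
  isoInverse φ = record
    { morphism = record
      { onV     = inverseFunc onV bijectiveV
      ; onD     = inverseFunc onD bijectiveD
      ; beg-hom = λ y → proj₁ bijectiveV (Δ.V.trans
          (Δ.V.sym (beg-hom _))
          (Δ.V.trans (Func.cong Δ.beg (to∘from onD bijectiveD y))
                     (Δ.V.sym (to∘from onV bijectiveV _))))
      ; inv-hom = λ y → proj₁ bijectiveD (Δ.D.trans
          (Δ.D.sym (inv-hom _))
          (Δ.D.trans (Func.cong Δ.inv (to∘from onD bijectiveD y))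
                     (Δ.D.sym (to∘from onD bijectiveD _))))
      }
    ; bijectiveV = inverseFunc-bijective onV bijectiveV
    ; bijectiveD = inverseFunc-bijective onD bijectiveD
    }
    where open Isomorphism φ

module _ {ℓ : Level} {Γ Δ Θ : Graph ℓ} where
  private
    module Θ = Graph Θ

  -- φ first, then ψ
  isoCompose : Isomorphism Γ Δ → Isomorphism Δ Θ → Isomorphism Γ Θ
  isoCompose φ ψ = record
    { morphism = record
      { onV     = Compose.function φ.onV ψ.onV
      ; onD     = Compose.function φ.onD ψ.onD
      ; beg-hom = λ x → Θ.V.trans (ψ.beg-hom _) (Func.cong ψ.onV (φ.beg-hom x))
      ; inv-hom = λ x → Θ.D.trans (ψ.inv-hom _) (Func.cong ψ.onD (φ.inv-hom x))
      }
    ; bijectiveV = Compose.bijective _ _ Θ.V._≈_ φ.bijectiveV ψ.bijectiveV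
    ; bijectiveD = Compose.bijective _ _ Θ.D._≈_ φ.bijectiveD ψ.bijectiveD
    }
    where
    module φ = Isomorphism φ
    module ψ = Isomorphism ψ

module _ {ℓ : Level} (Γ : Graph ℓ) where
  open Graph Γ
  open Isomorphism using (onV; onD; bijectiveV; bijectiveD)

  isoIdentity : Isomorphism Γ Γ
  isoIdentity = record
    { morphism = record
      { onV     = Identity.function V
      ; onD     = Identity.function D
      ; beg-hom = λ _ → V.refl
      ; inv-hom = λ _ → D.refl
      }
    ; bijectiveV = Identity.bijective V._≈_
    ; bijectiveD = Identity.bijective D._≈_
    }

  -- Automorphisms act on the right: g ∙ h is g followed by h.
  Aut : Group ℓ ℓ
  Aut = record
    { Carrier = Isomorphism Γ Γ
    ; _≈_     = λ g h → (∀ v → (onV g ⟨$⟩ v) V.≈ (onV h ⟨$⟩ v))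
                      × (∀ x → (onD g ⟨$⟩ x) D.≈ (onD h ⟨$⟩ x))
    ; _∙_     = isoCompose
    ; ε       = isoIdentity
    ; _⁻¹     = isoInverse
    ; isGroup = record
      { isMonoid = record
        { isSemigroup = record
          { isMagma = record
            { isEquivalence = record
              { refl  = (λ _ → V.refl) , (λ _ → D.refl)
              ; sym   = λ (p , q) → (λ v → V.sym (p v)) , (λ x → D.sym (q x))
              ; trans = λ (p , q) (p′ , q′) →
                  (λ v → V.trans (p v) (p′ v)) , (λ x → D.trans (q x) (q′ x))
              }
            ; ∙-cong = λ {g} {g′} {h} {h′} (p , q) (p′ , q′) →
                (λ v → V.trans (Func.cong (onV h) (p v)) (p′ _)) ,
                (λ x → D.trans (Func.cong (onD h) (q x)) (q′ _))
            }
          ; assoc = λ _ _ _ → (λ _ → V.refl) , (λ _ → D.refl)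
          }
        ; identity = (λ _ → (λ _ → V.refl) , (λ _ → D.refl))
                   , (λ _ → (λ _ → V.refl) , (λ _ → D.refl))
        }
      ; inverse = (λ g → to∘from (onV g) (bijectiveV g) , to∘from (onD g) (bijectiveD g))
                , (λ g → from∘to (onV g) (bijectiveV g) , from∘to (onD g) (bijectiveD g))
      ; ⁻¹-cong = λ {g} {h} (p , q) →
          (λ v → proj₁ (bijectiveV h) (V.trans (V.sym (p _))
            (V.trans (to∘from (onV g) (bijectiveV g) v)
                     (V.sym (to∘from (onV h) (bijectiveV h) v))))) ,
          (λ x → proj₁ (bijectiveD h) (D.trans (D.sym (q _))
            (D.trans (to∘from (onD g) (bijectiveD g) x)
                     (D.sym (to∘from (onD h) (bijectiveD h) x)))))
      }
    }

------------------------------------------------------------------------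
-- Quotients

module _ {ℓ : Level} (Γ : Graph ℓ) (G : Subgroup (Aut Γ)) where
  open Graph Γ
  open Isomorphism using (onV; onD; beg-hom; inv-hom)
  private module G = Group (subgroupGroup (Aut Γ) G)

  orbitV : V.Carrier → Pred V.Carrier ℓ
  orbitV v w = Σ[ g ∈ G.Carrier ] w V.≈ (onV (proj₁ g) ⟨$⟩ v)

  orbitD : D.Carrier → Pred D.Carrier ℓ
  orbitD x y = Σ[ g ∈ G.Carrier ] y D.≈ (onD (proj₁ g) ⟨$⟩ x)

  orbitV-self : ∀ v → v ∈ orbitV v
  orbitV-self v = G.ε , V.refl

  orbitD-self : ∀ x → x ∈ orbitD x
  orbitD-self x = G.ε , D.refl

  orbitV-⊆ : ∀ {v w} → v ∈ orbitV w → orbitV v ⊆ orbitV w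
  orbitV-⊆ (g , v≈wg) (h , u≈vh) =
    g G.∙ h , V.trans u≈vh (Func.cong (onV (proj₁ h)) v≈wg)

  orbitD-⊆ : ∀ {x y} → x ∈ orbitD y → orbitD x ⊆ orbitD y
  orbitD-⊆ (g , x≈yg) (h , z≈xh) =
    g G.∙ h , D.trans z≈xh (Func.cong (onD (proj₁ h)) x≈yg)

  -- The underlying types are those of Γ; an element x stands for its orbit x^G.
  quotient : Graph ℓ
  quotient = record
    { V = record
      { Carrier       = V.Carrier
      ; _≈_           = λ v w → orbitV v ≐ orbitV w
      ; isEquivalence = record { refl = ≐-refl ; sym = ≐-sym ; trans = ≐-trans }
      }
    ; D = record
      { Carrier       = D.Carrier
      ; _≈_           = λ x y → orbitD x ≐ orbitD y
      ; isEquivalence = record { refl = ≐-refl ; sym = ≐-sym ; trans = ≐-trans }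
      }
    ; beg = record
      { to   = beg ⟨$⟩_
      ; cong = λ {x} {y} (x⊆y , y⊆x) →
          orbitV-⊆ (begOrbit (x⊆y (orbitD-self x))) ,
          orbitV-⊆ (begOrbit (y⊆x (orbitD-self y)))
      }
    ; inv = record
      { to   = inv ⟨$⟩_
      ; cong = λ {x} {y} (x⊆y , y⊆x) →
          orbitD-⊆ (invOrbit (x⊆y (orbitD-self x))) ,
          orbitD-⊆ (invOrbit (y⊆x (orbitD-self y)))
      }
    ; inv-involutive = λ x →
        orbitD-⊆ (G.ε , inv-involutive x) ,
        orbitD-⊆ (G.ε , D.sym (inv-involutive x))
    ; nonEmpty = nonEmpty
    }
    where
    begOrbit : ∀ {x y} → x ∈ orbitD y → (beg ⟨$⟩ x) ∈ orbitV (beg ⟨$⟩ y)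
    begOrbit (g , x≈yg) = g , V.trans (Func.cong beg x≈yg) (beg-hom (proj₁ g) _)

    invOrbit : ∀ {x y} → x ∈ orbitD y → (inv ⟨$⟩ x) ∈ orbitD (inv ⟨$⟩ y)
    invOrbit (g , x≈yg) = g , D.trans (Func.cong inv x≈yg) (inv-hom (proj₁ g) _)

infixl 7 _/_
_/_ : {ℓ : Level} (Γ : Graph ℓ) → Subgroup (Aut Γ) → Graph ℓ
_/_ = quotient

------------------------------------------------------------------------
-- Generalised voltage graphs and generalised covers

module _ {ℓ : Level} (Δ : Graph ℓ) (G : Group ℓ ℓ)
         (ω : Func (Graph.V∪D Δ) (subgroups G))
         (ζ : Func (Graph.D Δ) (Group.setoid G)) where
  open Graph Δ
  open Group G using (Carrier; _≈_; _∙_; _⁻¹; ε; sym; assoc; setoid; ∙-congˡ; ∙-congʳ)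
  open Subgroup using (member)

  private
    ωV : V.Carrier → Subgroup G
    ωV v = ω ⟨$⟩ inj₁ v

    ωD : D.Carrier → Subgroup G
    ωD x = ω ⟨$⟩ inj₂ x

  record IsGeneralisedVoltageGraph : Set ℓ where
    field
      connected : Connected Δ
      ω-beg     : ∀ x → member (ωD x) ⊆ member (ωV (beg ⟨$⟩ x))
      ω-inv     : ∀ x → member (ωD x) ≐ conjugate G (ωD (inv ⟨$⟩ x)) (ζ ⟨$⟩ x)
      ζ-inv     : ∀ x → ((ζ ⟨$⟩ (inv ⟨$⟩ x)) ∙ (ζ ⟨$⟩ x)) ∈ member (ωD x)

  module _ (isGVG : IsGeneralisedVoltageGraph) where
    open IsGeneralisedVoltageGraph isGVG
    open GroupProperties G using (\\-leftDividesˡ)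

    -- A pair (x , g) stands for (x , ω(x)g).
    GenCov : Graph ℓ
    GenCov = record
      { V = record
        { Carrier       = V.Carrier × Carrier
        ; _≈_           = λ (v , g) (w , h) →
            v V.≈ w × rightCoset G (ωV v) g ≐ rightCoset G (ωV w) h
        ; isEquivalence = record
          { refl  = V.refl , ≐-refl
          ; sym   = λ (p , q) → V.sym p , ≐-sym q
          ; trans = λ (p , q) (p′ , q′) → V.trans p p′ , ≐-trans q q′
          }
        }
      ; D = record
        { Carrier       = D.Carrier × Carrier
        ; _≈_           = λ (x , g) (y , h) →
            x D.≈ y × rightCoset G (ωD x) g ≐ rightCoset G (ωD y) h
        ; isEquivalence = record
          { refl  = D.refl , ≐-refl
          ; sym   = λ (p , q) → D.sym p , ≐-sym q
          ; trans = λ (p , q) (p′ , q′) → D.trans p p′ , ≐-trans q q′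
          }
        }
      ; beg = record
        { to   = λ (x , g) → (beg ⟨$⟩ x) , g
        ; cong = begCong
        }
      ; inv = record
        { to   = λ (x , g) → (inv ⟨$⟩ x) , (ζ ⟨$⟩ x) ∙ g
        ; cong = invCong
        }
      ; inv-involutive = λ (x , g) →
          inv-involutive x ,
          rightCoset-≐ G (ωD (inv ⟨$⟩ (inv ⟨$⟩ x))) (ωD x)
            (Func.cong ω (inj₂ (inv-involutive x)))
            (ζ-inv x) (sym (assoc _ _ _))
      ; nonEmpty = nonEmpty , ε
      }
      where
      begCong : ∀ {p q : D.Carrier × Carrier} →
                (proj₁ p D.≈ proj₁ q ×
                 rightCoset G (ωD (proj₁ p)) (proj₂ p) ≐ rightCoset G (ωD (proj₁ q)) (proj₂ q)) →
                (beg ⟨$⟩ proj₁ p) V.≈ (beg ⟨$⟩ proj₁ q) ×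
                rightCoset G (ωV (beg ⟨$⟩ proj₁ p)) (proj₂ p) ≐
                rightCoset G (ωV (beg ⟨$⟩ proj₁ q)) (proj₂ q)
      begCong {x , g} {y , h} (x≈y , xg⊆yh , _)
        with a , a∈ , g≈ah ← xg⊆yh (rightCoset-self G (ωD x) g) =
          Func.cong beg x≈y ,
          rightCoset-≐ G (ωV (beg ⟨$⟩ x)) (ωV (beg ⟨$⟩ y))
            (Func.cong ω (inj₁ (Func.cong beg x≈y))) (ω-beg y a∈) g≈ah

      -- If g = ah with a ∈ ω(y) = ω(y⁻¹)^ζ(y), say a = ζ(y)⁻¹bζ(y) with
      -- b ∈ ω(y⁻¹), then ζ(x)g = ζ(y)ah = bζ(y)h.
      invCong : ∀ {p q : D.Carrier × Carrier} →
                (proj₁ p D.≈ proj₁ q ×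
                 rightCoset G (ωD (proj₁ p)) (proj₂ p) ≐ rightCoset G (ωD (proj₁ q)) (proj₂ q)) →
                (inv ⟨$⟩ proj₁ p) D.≈ (inv ⟨$⟩ proj₁ q) ×
                rightCoset G (ωD (inv ⟨$⟩ proj₁ p)) ((ζ ⟨$⟩ proj₁ p) ∙ proj₂ p) ≐
                rightCoset G (ωD (inv ⟨$⟩ proj₁ q)) ((ζ ⟨$⟩ proj₁ q) ∙ proj₂ q)
      invCong {x , g} {y , h} (x≈y , xg⊆yh , _)
        with a , a∈ , g≈ah ← xg⊆yh (rightCoset-self G (ωD x) g)
        with b , b∈ , a≈b^ζ ← proj₁ (ω-inv y) a∈ =
          Func.cong inv x≈y ,
          rightCoset-≐ G (ωD (inv ⟨$⟩ x)) (ωD (inv ⟨$⟩ y))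
            (Func.cong ω (inj₂ (Func.cong inv x≈y))) b∈ eq
        where
        open SetoidReasoning setoid
        ζx = ζ ⟨$⟩ x
        ζy = ζ ⟨$⟩ y
        eq : ζx ∙ g ≈ b ∙ (ζy ∙ h)
        eq = begin
          ζx ∙ g                        ≈⟨ ∙-congʳ (Func.cong ζ x≈y) ⟩
          ζy ∙ g                        ≈⟨ ∙-congˡ g≈ah ⟩
          ζy ∙ (a ∙ h)                  ≈⟨ assoc ζy a h ⟨
          (ζy ∙ a) ∙ h                  ≈⟨ ∙-congʳ (∙-congˡ a≈b^ζ) ⟩
          (ζy ∙ (ζy ⁻¹ ∙ b ∙ ζy)) ∙ h   ≈⟨ ∙-congʳ (∙-congˡ (assoc (ζy ⁻¹) b ζy)) ⟩
          (ζy ∙ (ζy ⁻¹ ∙ (b ∙ ζy))) ∙ h ≈⟨ ∙-congʳ (\\-leftDividesˡ ζy (b ∙ ζy)) ⟩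
          (b ∙ ζy) ∙ h                  ≈⟨ assoc b ζy h ⟩
          b ∙ (ζy ∙ h)                  ∎

{-# OPTIONS --safe #-}
-- Choose representatives t(v) of the vertex orbits, then representatives t(x)
-- of the dart orbits with beg t(x) = t(beg x), and finally ζ(x) ∈ G with
-- t(x)⁻¹ = t(x⁻¹)^ζ(x).  Let ω assign to an orbit the stabiliser of its
-- representative.  By the orbit-stabiliser correspondence (x , ω(x)g) ↦ t(x)^g
-- is an isomorphism from the generalised cover to Γ.
module Submission where

open import Defs
open import Level using (Level)
open import Algebra.Bundles using (Group)
import Algebra.Properties.Group as GroupProperties
open import Data.Product using (Σ-syntax; _×_; _,_; proj₁; proj₂)
open import Data.Sum using (inj₁; inj₂)
open import Data.Sum.Relation.Binary.Pointwise using (inj₁; inj₂)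
open import Function.Bundles using (Func; _⟨$⟩_)
open import Function.Definitions using (Bijective)
open import Relation.Binary.Bundles using (Setoid)
open import Relation.Unary using (Pred; _∈_; _≐_)
open import Relation.Unary.Properties using (≐-refl; ≐-sym; ≐-trans)
import Relation.Binary.Reasoning.Setoid as SetoidReasoning

-- Right actions on setoids, treating vertices and darts uniformly

record RightAction {ℓ : Level} (G : Group ℓ ℓ) (S : Setoid ℓ ℓ) : Set ℓ where
  private
    module G = Group G
  open Setoid S
  field
    _^_    : Carrier → G.Carrier → Carrier
    ^-cong : ∀ {x y g h} → x ≈ y → g G.≈ h → (x ^ g) ≈ (y ^ h)
    ^-ε    : ∀ x → (x ^ G.ε) ≈ x
    ^-∙    : ∀ x g h → (x ^ (g G.∙ h)) ≈ ((x ^ g) ^ h)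

  open Subgroup using (member)
  open GroupProperties G using (//-rightDividesˡ; \\-leftDividesʳ)
  open SetoidReasoning S

  ^-congʳ : ∀ {x y} g → x ≈ y → (x ^ g) ≈ (y ^ g)
  ^-congʳ g x≈y = ^-cong x≈y G.refl

  ^-⁻¹ : ∀ {x y g} → x ≈ (y ^ g) → y ≈ (x ^ (g G.⁻¹))
  ^-⁻¹ {x} {y} {g} x≈yg = begin
    y                   ≈⟨ ^-ε y ⟨
    y ^ G.ε             ≈⟨ ^-cong refl (G.inverseʳ g) ⟨
    y ^ (g G.∙ g G.⁻¹)  ≈⟨ ^-∙ y g (g G.⁻¹) ⟩
    (y ^ g) ^ (g G.⁻¹)  ≈⟨ ^-congʳ (g G.⁻¹) x≈yg ⟨
    x ^ (g G.⁻¹)        ∎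

  orbit : Carrier → Pred Carrier ℓ
  orbit x y = Σ[ g ∈ G.Carrier ] y ≈ (x ^ g)

  orbit-sym : ∀ {x y} → y ∈ orbit x → x ∈ orbit y
  orbit-sym (g , y≈xg) = g G.⁻¹ , ^-⁻¹ y≈xg

  orbit-trans : ∀ {x y z} → y ∈ orbit x → z ∈ orbit y → z ∈ orbit x
  orbit-trans {x} (g , y≈xg) (h , z≈yh) =
    g G.∙ h , trans z≈yh (trans (^-congʳ h y≈xg) (sym (^-∙ x g h)))

  orbit-≐ : ∀ {x y} → y ∈ orbit x → orbit x ≐ orbit y
  orbit-≐ y∈x = orbit-trans (orbit-sym y∈x) , orbit-trans y∈x

  -- For the actions on vertices and on darts this unfolds to the vertex and dart setoids of
  -- `Γ / G`.
  orbits : Setoid ℓ ℓ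
  orbits = record
    { Carrier       = Carrier
    ; _≈_           = λ x y → orbit x ≐ orbit y
    ; isEquivalence = record { refl = ≐-refl ; sym = ≐-sym ; trans = ≐-trans }
    }

  stabiliser : Carrier → Subgroup G
  stabiliser x = record
    { member    = λ g → (x ^ g) ≈ x
    ; resp-≈    = λ g≈h xg≈x → trans (^-cong refl (G.sym g≈h)) xg≈x
    ; ε-closed  = ^-ε x
    ; ∙-closed  = λ {g} {h} xg≈x xh≈x → trans (^-∙ x g h) (trans (^-congʳ h xg≈x) xh≈x)
    ; ⁻¹-closed = λ xg≈x → sym (^-⁻¹ (sym xg≈x))
    }

  stabiliser-cong : ∀ {x y} → x ≈ y → member (stabiliser x) ≐ member (stabiliser y)
  stabiliser-cong x≈y =
    (λ {g} xg≈x → trans (^-congʳ g (sym x≈y)) (trans xg≈x x≈y)) ,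
    (λ {g} yg≈y → trans (^-congʳ g x≈y) (trans yg≈y (sym x≈y)))

  -- An element `k` fixes `x ^ h` exactly when `h k h⁻¹` fixes `x`. This is the source of the
  -- condition `ω-inv`.
  stabiliser-^ : ∀ x h → member (stabiliser (x ^ h)) ≐ conjugate G (stabiliser x) h
  stabiliser-^ x h = to , from
    where
    to : ∀ {k} → k ∈ member (stabiliser (x ^ h)) → k ∈ conjugate G (stabiliser x) h
    to {k} xhk≈xh = (h G.∙ k) G.∙ h G.⁻¹ , fix , eq
      where
      fix : (x ^ ((h G.∙ k) G.∙ h G.⁻¹)) ≈ x
      fix = begin
        x ^ ((h G.∙ k) G.∙ h G.⁻¹)  ≈⟨ ^-∙ x (h G.∙ k) (h G.⁻¹) ⟩
        (x ^ (h G.∙ k)) ^ (h G.⁻¹)  ≈⟨ ^-⁻¹ (trans (^-∙ x h k) xhk≈xh) ⟨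
        x                           ∎
      eq : k G.≈ h G.⁻¹ G.∙ ((h G.∙ k) G.∙ h G.⁻¹) G.∙ h
      eq = G.sym (G.trans (G.assoc (h G.⁻¹) _ h)
             (G.trans (G.∙-congˡ (//-rightDividesˡ h (h G.∙ k))) (\\-leftDividesʳ h k)))
    from : ∀ {k} → k ∈ conjugate G (stabiliser x) h → k ∈ member (stabiliser (x ^ h))
    from {k} (a , xa≈x , k≈) = begin
      (x ^ h) ^ k                         ≈⟨ ^-cong refl k≈ ⟩
      (x ^ h) ^ (h G.⁻¹ G.∙ a G.∙ h)      ≈⟨ ^-∙ (x ^ h) (h G.⁻¹ G.∙ a) h ⟩
      ((x ^ h) ^ (h G.⁻¹ G.∙ a)) ^ h      ≈⟨ ^-congʳ h (^-∙ (x ^ h) (h G.⁻¹) a) ⟩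
      (((x ^ h) ^ (h G.⁻¹)) ^ a) ^ h      ≈⟨ ^-congʳ h (^-congʳ a (^-⁻¹ refl)) ⟨
      (x ^ a) ^ h                         ≈⟨ ^-congʳ h xa≈x ⟩
      x ^ h                               ∎

  -- Being a `Func` on `orbits`, `t` is constant on each orbit up to equality, so it picks one
  -- representative per orbit.
  module Transversal (t : Func orbits S) (t∈ : ∀ x → (t ⟨$⟩ x) ∈ orbit x) where

    -- Unfolds to the vertex or dart setoid of the generalised cover whose `ω` consists of
    -- stabilisers of representatives.
    cosets : Setoid ℓ ℓ
    cosets = record
      { Carrier       = Carrier × G.Carrier
      ; _≈_           = λ (x , g) (y , h) → orbit x ≐ orbit y
          × rightCoset G (stabiliser (t ⟨$⟩ x)) g ≐ rightCoset G (stabiliser (t ⟨$⟩ y)) h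
      ; isEquivalence = record
        { refl  = ≐-refl , ≐-refl
        ; sym   = λ (p , q) → ≐-sym p , ≐-sym q
        ; trans = λ (p , q) (p′ , q′) → ≐-trans p p′ , ≐-trans q q′
        }
      }

    fromCoset : Func cosets S
    fromCoset = record
      { to   = λ (x , g) → (t ⟨$⟩ x) ^ g
      ; cong = λ {p} {q} → well-defined {p} {q}
      }
      where
      well-defined : ∀ {p q} → Setoid._≈_ cosets p q →
                     ((t ⟨$⟩ proj₁ p) ^ proj₂ p) ≈ ((t ⟨$⟩ proj₁ q) ^ proj₂ q)
      well-defined {x , g} {y , h} (x≈y , xg⊆yh , _)
        -- As `g` lies in its own coset, it lies in that of `h`: they differ by some `a` fixing the
        -- representative.
        with a , ya≈y , g≈ah ← xg⊆yh (rightCoset-self G (stabiliser (t ⟨$⟩ x)) g) = begin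
          (t ⟨$⟩ x) ^ g          ≈⟨ ^-cong (Func.cong t x≈y) g≈ah ⟩
          (t ⟨$⟩ y) ^ (a G.∙ h)  ≈⟨ ^-∙ _ a h ⟩
          ((t ⟨$⟩ y) ^ a) ^ h    ≈⟨ ^-congʳ h ya≈y ⟩
          (t ⟨$⟩ y) ^ h          ∎

    fromCoset-bijective : Bijective (Setoid._≈_ cosets) _≈_ (fromCoset ⟨$⟩_)
    fromCoset-bijective = (λ {p} {q} → injective {p} {q}) , surjective
      where
      injective : ∀ {p q} → ((t ⟨$⟩ proj₁ p) ^ proj₂ p) ≈ ((t ⟨$⟩ proj₁ q) ^ proj₂ q) →
                  Setoid._≈_ cosets p q
      injective {x , g} {y , h} e = x≈y ,
          rightCoset-≐ G (stabiliser (t ⟨$⟩ x)) (stabiliser (t ⟨$⟩ y))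
            (stabiliser-cong (Func.cong t x≈y)) fix (G.sym (//-rightDividesˡ h g))
        where
        x≈y : orbit x ≐ orbit y
        -- The path runs from `x` to its representative, on to the common image, and back through
        -- the representative of `y`.
        x≈y = orbit-≐ (orbit-trans (t∈ x)
                (orbit-trans (g , sym e) (orbit-sym (orbit-trans (t∈ y) (h , refl)))))
        -- One orbit means one representative; `g` and `h` move it to the same point, so `g h⁻¹`
        -- stabilises it.
        fix : ((t ⟨$⟩ y) ^ (g G.∙ h G.⁻¹)) ≈ (t ⟨$⟩ y)
        fix = begin
          (t ⟨$⟩ y) ^ (g G.∙ h G.⁻¹)  ≈⟨ ^-cong (Func.cong t x≈y) G.refl ⟨
          (t ⟨$⟩ x) ^ (g G.∙ h G.⁻¹)  ≈⟨ ^-∙ _ g (h G.⁻¹) ⟩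
          ((t ⟨$⟩ x) ^ g) ^ (h G.⁻¹)  ≈⟨ ^-⁻¹ e ⟨
          t ⟨$⟩ y                     ∎
      surjective : ∀ y → Σ[ p ∈ Setoid.Carrier cosets ]
                     (∀ {q} → Setoid._≈_ cosets q p → (fromCoset ⟨$⟩ q) ≈ y)
      -- Reversing `t∈ y` gives a `g` that carries the representative to `y`.
      surjective y with g , y≈tg ← orbit-sym (t∈ y) =
        (y , g) , λ {q} q≈p → trans (Func.cong fromCoset {q} {y , g} q≈p) (sym y≈tg)

-- The generalised cover built from compatible representatives

module _ {ℓ : Level} (Γ : Graph ℓ) (G : Subgroup (Aut Γ)) where
  open Graph Γ
  open Isomorphism using (onV; onD; beg-hom; inv-hom)
  open Subgroup using (member)

  private
    H : Group ℓ ℓ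
    H = subgroupGroup (Aut Γ) G
    module H = Group H

    actionV : RightAction H V
    actionV = record
      { _^_    = λ v g → onV (proj₁ g) ⟨$⟩ v
      ; ^-cong = λ {_} {_} {g} v≈w (p , _) → V.trans (Func.cong (onV (proj₁ g)) v≈w) (p _)
      ; ^-ε    = λ _ → V.refl
      ; ^-∙    = λ _ _ _ → V.refl
      }

    actionD : RightAction H D
    actionD = record
      { _^_    = λ x g → onD (proj₁ g) ⟨$⟩ x
      ; ^-cong = λ {_} {_} {g} x≈y (_ , q) → D.trans (Func.cong (onD (proj₁ g)) x≈y) (q _)
      ; ^-ε    = λ _ → D.refl
      ; ^-∙    = λ _ _ _ → D.refl
      }

    module ActionV = RightAction actionV
    module ActionD = RightAction actionD

  -- Choice serves only to supply these parameters. `beg-tD` and `inv-tD` are the homomorphism laws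
  -- of the isomorphism at the cosets of the identity.
  module Cover
    (connected : Connected (Γ / G))
    (tV : Func (Graph.V (Γ / G)) V) (tV∈ : ∀ v → (tV ⟨$⟩ v) ∈ orbitV Γ G v)
    (tD : Func (Graph.D (Γ / G)) D) (tD∈ : ∀ x → (tD ⟨$⟩ x) ∈ orbitD Γ G x)
    (beg-tD : ∀ x → (beg ⟨$⟩ (tD ⟨$⟩ x)) V.≈ (tV ⟨$⟩ (beg ⟨$⟩ x)))
    (ζ : Func (Graph.D (Γ / G)) H.setoid)
    (inv-tD : ∀ x → (inv ⟨$⟩ (tD ⟨$⟩ x)) D.≈ (onD (proj₁ (ζ ⟨$⟩ x)) ⟨$⟩ (tD ⟨$⟩ (inv ⟨$⟩ x))))
    where

    ω : Func (Graph.V∪D (Γ / G)) (subgroups H)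
    ω = record
      { to   = λ { (inj₁ v) → ActionV.stabiliser (tV ⟨$⟩ v)
                 ; (inj₂ x) → ActionD.stabiliser (tD ⟨$⟩ x) }
      ; cong = λ { (inj₁ v≈w) → ActionV.stabiliser-cong (Func.cong tV v≈w)
                 ; (inj₂ x≈y) → ActionD.stabiliser-cong (Func.cong tD x≈y) }
      }

    -- Automorphisms commute with `inv`, so one fixing a dart fixes its inverse; involutivity gives
    -- the converse.
    stabiliser-inv : ∀ x → member (ActionD.stabiliser x) ≐ member (ActionD.stabiliser (inv ⟨$⟩ x))
    stabiliser-inv x =
      (λ {g} → fixes-inv g x) ,
      (λ {g} p → proj₁ (ActionD.stabiliser-cong (inv-involutive x)) {g} (fixes-inv g (inv ⟨$⟩ x) p))
      where
      fixes-inv : ∀ g x → g ∈ member (ActionD.stabiliser x) →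
                  g ∈ member (ActionD.stabiliser (inv ⟨$⟩ x))
      fixes-inv g x xg≈x = D.trans (D.sym (inv-hom (proj₁ g) x)) (Func.cong inv xg≈x)

    isGVG : IsGeneralisedVoltageGraph (Γ / G) H ω ζ
    isGVG = record
      { connected = connected
      ; ω-beg     = λ x {g} → ω-beg x g
      -- Pass from t(x) to t(x)⁻¹, rewrite that as t(x⁻¹)^ζ(x), then conjugate the stabiliser.
      ; ω-inv     = λ x → ≐-trans (stabiliser-inv (tD ⟨$⟩ x))
                      (≐-trans (ActionD.stabiliser-cong (inv-tD x))
                               (ActionD.stabiliser-^ (tD ⟨$⟩ (inv ⟨$⟩ x)) (ζ ⟨$⟩ x)))
      ; ζ-inv     = ζ-inv
      }
      where
      -- An automorphism fixing a dart fixes its initial vertex, which `beg-tD` identifies with the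
      -- chosen representative.
      ω-beg : ∀ x g → g ∈ member (ω ⟨$⟩ inj₂ x) → g ∈ member (ω ⟨$⟩ inj₁ (beg ⟨$⟩ x))
      ω-beg x g xg≈x = begin
        onV (proj₁ g) ⟨$⟩ (tV ⟨$⟩ (beg ⟨$⟩ x))  ≈⟨ Func.cong (onV (proj₁ g)) (beg-tD x) ⟨
        onV (proj₁ g) ⟨$⟩ (beg ⟨$⟩ (tD ⟨$⟩ x))  ≈⟨ beg-hom (proj₁ g) _ ⟨
        beg ⟨$⟩ (onD (proj₁ g) ⟨$⟩ (tD ⟨$⟩ x))  ≈⟨ Func.cong beg xg≈x ⟩
        beg ⟨$⟩ (tD ⟨$⟩ x)                      ≈⟨ beg-tD x ⟩
        tV ⟨$⟩ (beg ⟨$⟩ x)                      ∎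
        where open SetoidReasoning V

      -- By `inv-tD` at x⁻¹ and then at x, ζ(x⁻¹) takes t(x) to t(x⁻¹)⁻¹, which ζ(x) takes to t(x).
      ζ-inv : ∀ x → ((ζ ⟨$⟩ (inv ⟨$⟩ x)) H.∙ (ζ ⟨$⟩ x)) ∈ member (ω ⟨$⟩ inj₂ x)
      ζ-inv x = begin
        onD z ⟨$⟩ (onD z′ ⟨$⟩ (tD ⟨$⟩ x))
          ≈⟨ Func.cong (onD z) (Func.cong (onD z′)
               (Func.cong tD (Graph.inv-involutive (Γ / G) x))) ⟨
        onD z ⟨$⟩ (onD z′ ⟨$⟩ (tD ⟨$⟩ (inv ⟨$⟩ (inv ⟨$⟩ x))))
          ≈⟨ Func.cong (onD z) (inv-tD (inv ⟨$⟩ x)) ⟨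
        onD z ⟨$⟩ (inv ⟨$⟩ (tD ⟨$⟩ (inv ⟨$⟩ x)))
          ≈⟨ inv-hom z _ ⟨
        inv ⟨$⟩ (onD z ⟨$⟩ (tD ⟨$⟩ (inv ⟨$⟩ x)))
          ≈⟨ Func.cong inv (inv-tD x) ⟨
        inv ⟨$⟩ (inv ⟨$⟩ (tD ⟨$⟩ x))
          ≈⟨ inv-involutive _ ⟩
        tD ⟨$⟩ x ∎
        where
        open SetoidReasoning D
        z  = proj₁ (ζ ⟨$⟩ x)
        z′ = proj₁ (ζ ⟨$⟩ (inv ⟨$⟩ x))

    genCov≅Γ : Isomorphism (GenCov (Γ / G) H ω ζ isGVG) Γ
    genCov≅Γ = record
      { morphism = record
        { onV     = TV.fromCoset
        ; onD     = TD.fromCoset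
        -- Since `g` commutes with `beg` and `inv`, both laws reduce to the representatives.
        ; beg-hom = λ (x , g) →
            V.trans (beg-hom (proj₁ g) _) (Func.cong (onV (proj₁ g)) (beg-tD x))
        ; inv-hom = λ (x , g) →
            D.trans (inv-hom (proj₁ g) _) (Func.cong (onD (proj₁ g)) (inv-tD x))
        }
      ; bijectiveV = TV.fromCoset-bijective
      ; bijectiveD = TD.fromCoset-bijective
      }
      where
      module TV = ActionV.Transversal tV tV∈
      module TD = ActionD.Transversal tD tD∈

  -- Choosing representatives and voltages

  module _ (ac : AxiomOfChoice ℓ) where

    vertexTransversal : Σ[ t ∈ Func (Graph.V (Γ / G)) V ] (∀ v → (t ⟨$⟩ v) ∈ orbitV Γ G v)
    vertexTransversal = ac (Graph.V (Γ / G)) V (λ v w → w ∈ orbitV Γ G v)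
      (λ (v⊆w , _) → v⊆w)
      (λ w≈w′ (g , w≈vg) → g , V.trans (V.sym w≈w′) w≈vg)
      (λ v → v , orbitV-self Γ G v)

    dartTransversal : (tV : Func (Graph.V (Γ / G)) V) → (∀ v → (tV ⟨$⟩ v) ∈ orbitV Γ G v) →
      Σ[ t ∈ Func (Graph.D (Γ / G)) D ]
        (∀ x → (t ⟨$⟩ x) ∈ orbitD Γ G x × (beg ⟨$⟩ (t ⟨$⟩ x)) V.≈ (tV ⟨$⟩ (beg ⟨$⟩ x)))
    dartTransversal tV tV∈ = ac (Graph.D (Γ / G)) D
      (λ x y → y ∈ orbitD Γ G x × (beg ⟨$⟩ y) V.≈ (tV ⟨$⟩ (beg ⟨$⟩ x)))
      (λ x≈x′ (y∈x , e) →
        proj₁ x≈x′ y∈x , V.trans e (Func.cong tV (Func.cong (Graph.beg (Γ / G)) x≈x′)))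
      (λ y≈y′ ((g , y≈xg) , e) →
        (g , D.trans (D.sym y≈y′) y≈xg) , V.trans (Func.cong beg (D.sym y≈y′)) e)
      -- The `g` moving `beg x` to its representative moves `x` to a dart of its orbit that starts
      -- there.
      (λ x → let g , e = tV∈ (beg ⟨$⟩ x) in
        (onD (proj₁ g) ⟨$⟩ x) , (g , D.refl) , V.trans (beg-hom (proj₁ g) x) (V.sym e))

    voltages : (t : Func (Graph.D (Γ / G)) D) → (∀ x → (t ⟨$⟩ x) ∈ orbitD Γ G x) →
      Σ[ ζ ∈ Func (Graph.D (Γ / G)) H.setoid ]
        (∀ x → (inv ⟨$⟩ (t ⟨$⟩ x)) D.≈ (onD (proj₁ (ζ ⟨$⟩ x)) ⟨$⟩ (t ⟨$⟩ (inv ⟨$⟩ x))))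
    voltages t t∈ = ac (Graph.D (Γ / G)) H.setoid
      (λ x g → (inv ⟨$⟩ (t ⟨$⟩ x)) D.≈ (onD (proj₁ g) ⟨$⟩ (t ⟨$⟩ (inv ⟨$⟩ x))))
      (λ {g} x≈y e → D.trans (Func.cong inv (Func.cong t (Setoid.sym (Graph.D (Γ / G)) x≈y)))
        (D.trans e (Func.cong (onD (proj₁ g))
          (Func.cong t (Func.cong (Graph.inv (Γ / G)) x≈y)))))
      (λ (_ , q) e → D.trans e (q _))
      -- Both t(x⁻¹) and t(x)⁻¹ lie in the orbit of x⁻¹, so some group element carries the first to
      -- the second.
      (λ x → ActionD.orbit-trans (ActionD.orbit-sym (t∈ (inv ⟨$⟩ x)))
        (let g , e = t∈ x in g , D.trans (Func.cong inv e) (inv-hom (proj₁ g) x)))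

theorem4 : {ℓ : Level} → AxiomOfChoice ℓ →
    (Γ : Graph ℓ) (G : Subgroup (Aut Γ)) → Connected (Γ / G) →
    Σ[ ζ ∈ Func (Graph.D (Γ / G)) (Group.setoid (subgroupGroup (Aut Γ) G)) ]
    Σ[ ω ∈ Func (Graph.V∪D (Γ / G)) (subgroups (subgroupGroup (Aut Γ) G)) ]
    Σ[ isGVG ∈ IsGeneralisedVoltageGraph (Γ / G) (subgroupGroup (Aut Γ) G) ω ζ ]
    Isomorphism Γ (GenCov (Γ / G) (subgroupGroup (Aut Γ) G) ω ζ isGVG)
theorem4 ac Γ G connected =
  let tV , tV∈    = vertexTransversal Γ G ac
      tD , tD-rep = dartTransversal Γ G ac tV tV∈
      tD∈         = λ x → proj₁ (tD-rep x)
      ζ , inv-tD  = voltages Γ G ac tD tD∈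
      open Cover Γ G connected tV tV∈ tD tD∈ (λ x → proj₂ (tD-rep x)) ζ inv-tD
  in ζ , ω , isGVG , isoInverse genCov≅Γ
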